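{- The axiom system $EL_{int}$ is complete with respect to the class of all topo-models: for every formula $\varphi\in\mathcal{L}_{EL_{int}}$, if $\varphi$ is valid in every topo-model, then $\varphi$ is a theorem of $EL_{int}$.
   Context: Fix a countable set $\mathit{Prop}$ of propositional variables and a finite non-empty set $\mathcal{A}$ of agents. The language $\mathcal{L}_{EL_{int}}$ is given by $\varphi ::= p \mid \neg\varphi \mid \varphi\wedge\varphi \mid K_i\varphi \mid \mathrm{int}(\varphi)$ with $p\in\mathit{Prop}$, $i\in\mathcal{A}$; $\vee,\rightarrow,\leftrightarrow$ are the usual abbreviations, $\bot := p\wedge\neg p$, $\hat K_i\varphi:=\neg K_i\neg\varphi$. Topo-models: Let $(X,\tau)$ be a topological space and write $\mathrm{Int}(A)$ for the topological interior of $A\subseteq X$. A neighbourhood function set $\Phi$ on $(X,\tau)$ is a set of partial functions $\theta$ from $X$ to the set of functions $\mathcal{A}\to\tau$ such that for all $x,y\in Dom(\theta)$, all $i\in\mathcal{A}$ and all $U\in\tau$: (1) $\theta(x)(i)\in\tau$; (2) $x\in\theta(x)(i)$; (3) $\theta(x)(i)\subseteq Dom(\theta)$; (4) if $y\in\theta(x)(i)$ then $\theta(x)(i)=\theta(y)(i)$; (5) $\theta|_U\in\Phi$, where $\theta|_U$ is the partial function with $Dom(\theta|_U)=Dom(\theta)\cap U$ and $\theta|_U(x)(i)=\theta(x)(i)\cap U$. A topo-model is $\mathcal{M}=(X,\tau,\Phi,V)$ with $(X,\tau)$ a topological space, $\Phi$ a neighbourhood function set on it, and $V$ assigning to each $p\in\mathit{Prop}$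 a subset of $X$. A neighbourhood situation is a pair $(x,\theta)$ with $\theta\in\Phi$, $x\in Dom(\theta)$. Semantics: $(x,\theta)\models p$ iff $x\in V(p)$; Boolean clauses as usual; $(x,\theta)\models K_i\varphi$ iff $(y,\theta)\models\varphi$ for all $y\in\theta(x)(i)$; $(x,\theta)\models\mathrm{int}(\varphi)$ iff $x\in\mathrm{Int}([\![\varphi]\!]^\theta)$, where $[\![\varphi]\!]^\theta=\{y\in Dom(\theta)\mid (y,\theta)\models\varphi\}$. $\varphi$ is valid in $\mathcal{M}$ if it is true at every neighbourhood situation of $\mathcal{M}$. The axiom system $EL_{int}$ has axioms: all instances of propositional tautologies; $K_i(\varphi\to\psi)\to(K_i\varphi\to K_i\psi)$; $K_i\varphi\to\varphi$; $K_i\varphi\to K_iK_i\varphi$; $\neg K_i\varphi\to K_i\neg K_i\varphi$; $\mathrm{int}(\varphi\to\psi)\to(\mathrm{int}(\varphi)\to\mathrm{int}(\psi))$; $\mathrm{int}(\varphi)\to\varphi$; $\mathrm{int}(\varphi)\to\mathrm{int}(\mathrm{int}(\varphi))$; $K_i\varphi\to\mathrm{int}(\varphi)$; and rules: modus ponens, from $\varphi$ infer $K_i\varphi$, from $\varphi$ infer $\mathrm{int}(\varphi)$. Theorems are the members of the smallest set containing the axioms and closed under the rules. -}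

module Defs where

open import Data.Bool.Base using (Bool; true; not) renaming (_∧_ to _and_)
open import Data.Nat.Base using (ℕ)
open import Data.Product.Base using (Σ-syntax; _×_; _,_; proj₁; proj₂)
open import Level using (Lift; 0ℓ; _⊔_) renaming (suc to lsuc)
open import Relation.Binary.PropositionalEquality.Core using (_≡_)
open import Relation.Nullary.Negation.Core using (¬_)
open import Relation.Unary using (Pred; _∈_; _⊆_; _≐_; _∩_; ⋃; ∅; U)

infixr 6 _∧_
infixr 5 _⇒_
infixr 7 ∼_

data Form (P A : Set) : Set where
  atom : P → Form P A
  ∼_   : Form P A → Form P A
  _∧_  : Form P A → Form P A → Form P A
  K    : A → Form P A → Form P A
  int  : Form P A → Form P A

_⇒_ : ∀ {P A} → Form P A → Form P A → Form P A
φ ⇒ ψ = ∼ (φ ∧ ∼ ψ)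

-- Propositional schemes, with the schematic letters numbered by ℕ so that
-- there are enough of them even when the set of propositional variables is
-- finite.

data Scheme : Set where
  var  : ℕ → Scheme
  neg  : Scheme → Scheme
  conj : Scheme → Scheme → Scheme

eval : (ℕ → Bool) → Scheme → Bool
eval v (var n)    = v n
eval v (neg α)    = not (eval v α)
eval v (conj α β) = eval v α and eval v β

Tautology : Scheme → Set
Tautology α = ∀ v → eval v α ≡ true

_[_] : ∀ {P A} → Scheme → (ℕ → Form P A) → Form P A
var n    [ σ ] = σ n
neg α    [ σ ] = ∼ (α [ σ ])
conj α β [ σ ] = (α [ σ ]) ∧ (β [ σ ])

infix 3 ⊢_

data ⊢_ {P A : Set} : Form P A → Set where
  taut  : ∀ α → Tautology α → (σ : ℕ → Form P A) → ⊢ α [ σ ]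
  K-K   : ∀ i φ ψ → ⊢ K i (φ ⇒ ψ) ⇒ (K i φ ⇒ K i ψ)
  K-T   : ∀ i φ → ⊢ K i φ ⇒ φ
  K-4   : ∀ i φ → ⊢ K i φ ⇒ K i (K i φ)
  K-5   : ∀ i φ → ⊢ ∼ K i φ ⇒ K i (∼ K i φ)
  int-K : ∀ φ ψ → ⊢ int (φ ⇒ ψ) ⇒ (int φ ⇒ int ψ)
  int-T : ∀ φ → ⊢ int φ ⇒ φ
  int-4 : ∀ φ → ⊢ int φ ⇒ int (int φ)
  K-int : ∀ i φ → ⊢ K i φ ⇒ int φ
  mp    : ∀ {φ ψ} → ⊢ φ ⇒ ψ → ⊢ φ → ⊢ ψ
  nec-K   : ∀ i {φ} → ⊢ φ → ⊢ K i φ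
  nec-int : ∀ {φ} → ⊢ φ → ⊢ int φ

-- Subsets are predicates and equality of subsets is _≐_, so every set of
-- subsets (or of partial functions, below) is required to respect it.

record Topology (X : Set) : Set₂ where
  field
    Open      : Pred (Pred X 0ℓ) (lsuc 0ℓ)
    Open-resp : ∀ {O O′} → O ≐ O′ → Open O → Open O′
    Open-∅    : Open ∅
    Open-U    : Open U
    Open-∩    : ∀ {O O′} → Open O → Open O′ → Open (O ∩ O′)
    Open-⋃    : (I : Set) (O : I → Pred X 0ℓ) → (∀ i → Open (O i)) → Open (⋃ I O)

  Int : ∀ {ℓ} → Pred X ℓ → Pred X (lsuc 0ℓ ⊔ ℓ)
  Int S x = Σ[ O ∈ Pred X 0ℓ ] Open O × O ⊆ S × x ∈ O

-- Partial functions from X to A → 𝒫(X).  A value is computed from a proof of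
-- membership in the domain; app-irr says that it does not depend on the proof.

record PartialFn (X A : Set) : Set₁ where
  field
    Dom     : Pred X 0ℓ
    app     : ∀ x → x ∈ Dom → A → Pred X 0ℓ
    app-irr : ∀ x (d d′ : x ∈ Dom) i → app x d i ≐ app x d′ i

open PartialFn public

_≈_ : ∀ {X A} → PartialFn X A → PartialFn X A → Set
θ ≈ θ′ = Dom θ ≐ Dom θ′ × (∀ x d d′ i → app θ x d i ≐ app θ′ x d′ i)

_∣_ : ∀ {X A} → PartialFn X A → Pred X 0ℓ → PartialFn X A
(θ ∣ O) .Dom = Dom θ ∩ O
(θ ∣ O) .app x (d , _) i = app θ x d i ∩ O
(θ ∣ O) .app-irr x (d , _) (d′ , _) i =
  (λ (p , q) → proj₁ (app-irr θ x d d′ i) p , q) ,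
  (λ (p , q) → proj₂ (app-irr θ x d d′ i) p , q)

record IsNbhdFnSet {X : Set} (A : Set) (τ : Topology X)
                   (Φ : Pred (PartialFn X A) (lsuc 0ℓ)) : Set₁ where
  open Topology τ
  field
    resp     : ∀ {θ θ′} → θ ≈ θ′ → θ ∈ Φ → θ′ ∈ Φ
    open-val : ∀ {θ} → θ ∈ Φ → ∀ x (d : x ∈ Dom θ) i → Open (app θ x d i)
    refl-val : ∀ {θ} → θ ∈ Φ → ∀ x (d : x ∈ Dom θ) i → x ∈ app θ x d i
    val⊆Dom  : ∀ {θ} → θ ∈ Φ → ∀ x (d : x ∈ Dom θ) i → app θ x d i ⊆ Dom θ
    val-≐    : ∀ {θ} → θ ∈ Φ → ∀ x y (d : x ∈ Dom θ) (e : y ∈ Dom θ) i →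
               y ∈ app θ x d i → app θ x d i ≐ app θ y e i
    restrict : ∀ {θ} → θ ∈ Φ → ∀ O → Open O → (θ ∣ O) ∈ Φ

record TopoModel (P A : Set) : Set₂ where
  field
    X           : Set
    τ           : Topology X
    Φ           : Pred (PartialFn X A) (lsuc 0ℓ)
    isNbhdFnSet : IsNbhdFnSet A τ Φ
    V           : P → Pred X 0ℓ

  open Topology τ public
  open IsNbhdFnSet isNbhdFnSet public

module Semantics {P A : Set} (M : TopoModel P A) where
  open TopoModel M

  record Situation : Set₁ where
    constructor ⟨_,_,_,_⟩
    field
      x   : X
      θ   : PartialFn X A
      θ∈Φ : θ ∈ Φ
      x∈θ : x ∈ Dom θ

  infix 4 _⊨_

  _⊨_ : Situation → Form P A → Set₁
  ⟨ x , _ , _ , _ ⟩     ⊨ atom p  = Lift (lsuc 0ℓ) (x ∈ V p)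
  s                     ⊨ ∼ φ     = ¬ (s ⊨ φ)
  s                     ⊨ φ ∧ ψ   = (s ⊨ φ) × (s ⊨ ψ)
  ⟨ x , θ , θ∈Φ , x∈θ ⟩ ⊨ K i φ   =
    ∀ y (y∈ : y ∈ app θ x x∈θ i) → ⟨ y , θ , θ∈Φ , val⊆Dom θ∈Φ x x∈θ i y∈ ⟩ ⊨ φ
  ⟨ x , θ , θ∈Φ , x∈θ ⟩ ⊨ int φ   =
    x ∈ Int (λ y → Σ[ y∈θ ∈ y ∈ Dom θ ] ⟨ y , θ , θ∈Φ , y∈θ ⟩ ⊨ φ)

ValidIn : ∀ {P A} → TopoModel P A → Form P A → Set₁
ValidIn M φ = ∀ s → s ⊨ φ
  where open Semantics M

{-# OPTIONS --safe #-}
module Submission where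

-- Pratt-style elimination.  Start from all truth assignments t to the atomic
-- and modal subformulas of φ, and repeatedly discard those that violate the
-- T axiom or have a false □ψ without a surviving related assignment refuting
-- ψ.  A discarded assignment, read as a set of literals, is inconsistent in
-- the calculus.  The survivors form a finite topo-model, with the up-sets of
-- the S4 relation as open sets and the S5 classes as neighbourhoods, in which
-- truth is given by the assignments; so if φ is valid, every survivor entails
-- φ, hence every assignment does, hence φ is derivable.

open import Defs
open import Data.Fin.Base using (Fin)
open import Data.Fin.Properties using () renaming (_≟_ to _≟ᶠ_)
open import Data.List.Base using (List; []; _∷_; _++_; map; filter; length)
open import Data.List.Membership.Propositional using (find; lose) renaming (_∈_ to _∈ˡ_; _∉_ to _∉ˡ_)
open import Data.List.Membership.Propositional.Properties using (∈-++⁺ˡ; ∈-++⁺ʳ; ∈-++⁻; ∈-map⁺; ∈-map⁻; ∈-filter⁺; ∈-filter⁻)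
open import Data.List.Properties using (filter-notAll)
open import Data.List.Relation.Binary.Subset.Propositional using () renaming (_⊆_ to _⊆ˡ_)
open import Data.List.Relation.Unary.All using (All; all?; lookup; tabulate)
open import Data.List.Relation.Unary.All.Properties using (¬All⇒Any¬)
open import Data.List.Relation.Unary.Any using (Any; any?; here; there)
open import Data.Bool.Base using (true; false)
open import Data.Nat.Base using (ℕ; suc; _<_)
open import Data.Nat.Induction using (Acc; acc; <-wellFounded)
open import Data.Nat.Properties using () renaming (_≟_ to _≟ⁿ_)
open import Data.Product.Base using (∃; _×_; _,_; proj₁; proj₂; uncurry)
open import Data.Sum.Base using (_⊎_; inj₁; inj₂; [_,_]′)
open import Data.Unit.Base using (⊤; tt)
open import Function.Base using (_∘_; id; const)
open import Function.Bundles using (_↣_; _↔_; _⇔_; mk⇔; module Equivalence)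
open import Function.Properties.Inverse using (↔⇒↣)
open import Level using (Lift; lift; lower; 0ℓ) renaming (suc to lsuc)
open import Relation.Binary.Definitions using (DecidableEquality)
open import Relation.Binary.PropositionalEquality using (_≡_; refl; cong; cong₂)
open import Relation.Nullary using (¬_; Dec; yes; no; contradiction; _×-dec_; _→-dec_; ¬?)
open import Relation.Nullary.Decidable using (map′; via-injection; decidable-stable)
open import Relation.Unary using (Pred; _∈_; _⊆_; _≐_; U; Decidable)

open Equivalence using (to; from)

-- Decidable equality of formulas.

module _ {P A : Set} (_≟ᴾ_ : DecidableEquality P) (_≟ᴬ_ : DecidableEquality A) where

  form-≟ : DecidableEquality (Form P A)
  form-≟ (atom p) (atom q)  = map′ (cong atom) (λ { refl → refl }) (p ≟ᴾ q)
  form-≟ (∼ φ)    (∼ ψ)     = map′ (cong ∼_) (λ { refl → refl }) (form-≟ φ ψ)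
  form-≟ (φ ∧ ψ)  (φ′ ∧ ψ′) = map′ (uncurry (cong₂ _∧_)) (λ { refl → refl , refl })
                                   (form-≟ φ φ′ ×-dec form-≟ ψ ψ′)
  form-≟ (K i φ)  (K j ψ)   = map′ (uncurry (cong₂ K)) (λ { refl → refl , refl })
                                   (i ≟ᴬ j ×-dec form-≟ φ ψ)
  form-≟ (int φ)  (int ψ)   = map′ (cong int) (λ { refl → refl }) (form-≟ φ ψ)
  form-≟ (atom _) (∼ _)     = no λ ()
  form-≟ (atom _) (_ ∧ _)   = no λ ()
  form-≟ (atom _) (K _ _)   = no λ ()
  form-≟ (atom _) (int _)   = no λ ()
  form-≟ (∼ _)    (atom _)  = no λ ()
  form-≟ (∼ _)    (_ ∧ _)   = no λ ()
  form-≟ (∼ _)    (K _ _)   = no λ ()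
  form-≟ (∼ _)    (int _)   = no λ ()
  form-≟ (_ ∧ _)  (atom _)  = no λ ()
  form-≟ (_ ∧ _)  (∼ _)     = no λ ()
  form-≟ (_ ∧ _)  (K _ _)   = no λ ()
  form-≟ (_ ∧ _)  (int _)   = no λ ()
  form-≟ (K _ _)  (atom _)  = no λ ()
  form-≟ (K _ _)  (∼ _)     = no λ ()
  form-≟ (K _ _)  (_ ∧ _)   = no λ ()
  form-≟ (K _ _)  (int _)   = no λ ()
  form-≟ (int _)  (atom _)  = no λ ()
  form-≟ (int _)  (∼ _)     = no λ ()
  form-≟ (int _)  (_ ∧ _)   = no λ ()
  form-≟ (int _)  (K _ _)   = no λ ()

data Modality (A : Set) : Set where
  know     : A → Modality A
  interior : Modality A

-- The agents whose knowledge literals survive under a modality. For `interior` these are all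
-- agents, since `K-int` turns anything known into an interior fact.
data Concerns {A : Set} : Modality A → A → Set where
  self  : ∀ {i} → Concerns (know i) i
  every : ∀ {i} → Concerns interior i

module _ {P A : Set} where

  private
    F : Set
    F = Form P A

  -- Propositional theorems

  private
    infixr 5 _⇒ˢ_
    _⇒ˢ_ : Scheme → Scheme → Scheme
    α ⇒ˢ β = neg (conj α (neg β))

    a b c : Scheme
    a = var 0
    b = var 1
    c = var 2

    assign : F → F → F → ℕ → F
    assign φ ψ χ 0 = φ
    assign φ ψ χ 1 = ψ
    assign φ ψ χ _ = χ

  ⇒-refl : (φ : F) → ⊢ φ ⇒ φ
  ⇒-refl φ = taut (a ⇒ˢ a) valid (assign φ φ φ)
    where
    valid : Tautology (a ⇒ˢ a)
    valid v with v 0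
    ... | true  = refl
    ... | false = refl

  ⇒-const : (φ ψ : F) → ⊢ φ ⇒ ψ ⇒ φ
  ⇒-const φ ψ = taut (a ⇒ˢ b ⇒ˢ a) valid (assign φ ψ ψ)
    where
    valid : Tautology (a ⇒ˢ b ⇒ˢ a)
    valid v with v 0 | v 1
    ... | true  | true  = refl
    ... | true  | false = refl
    ... | false | true  = refl
    ... | false | false = refl

  ⇒-distrib : (φ ψ χ : F) → ⊢ (φ ⇒ ψ ⇒ χ) ⇒ (φ ⇒ ψ) ⇒ φ ⇒ χ
  ⇒-distrib φ ψ χ = taut ((a ⇒ˢ b ⇒ˢ c) ⇒ˢ (a ⇒ˢ b) ⇒ˢ a ⇒ˢ c) valid (assign φ ψ χ)
    where
    valid : Tautology ((a ⇒ˢ b ⇒ˢ c) ⇒ˢ (a ⇒ˢ b) ⇒ˢ a ⇒ˢ c)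
    valid v with v 0 | v 1 | v 2
    ... | true  | true  | true  = refl
    ... | true  | true  | false = refl
    ... | true  | false | true  = refl
    ... | true  | false | false = refl
    ... | false | true  | true  = refl
    ... | false | true  | false = refl
    ... | false | false | true  = refl
    ... | false | false | false = refl

  ⇒-cases : (φ ψ : F) → ⊢ (φ ⇒ ψ) ⇒ (∼ φ ⇒ ψ) ⇒ ψ
  ⇒-cases φ ψ = taut ((a ⇒ˢ b) ⇒ˢ (neg a ⇒ˢ b) ⇒ˢ b) valid (assign φ ψ ψ)
    where
    valid : Tautology ((a ⇒ˢ b) ⇒ˢ (neg a ⇒ˢ b) ⇒ˢ b)
    valid v with v 0 | v 1
    ... | true  | true  = refl
    ... | true  | false = refl
    ... | false | true  = refl
    ... | false | false = refl

  ∼-explode : (φ ψ : F) → ⊢ φ ⇒ ∼ φ ⇒ ψ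
  ∼-explode φ ψ = taut (a ⇒ˢ neg a ⇒ˢ b) valid (assign φ ψ ψ)
    where
    valid : Tautology (a ⇒ˢ neg a ⇒ˢ b)
    valid v with v 0 | v 1
    ... | true  | true  = refl
    ... | true  | false = refl
    ... | false | true  = refl
    ... | false | false = refl

  ∼∼-intro : (φ : F) → ⊢ φ ⇒ ∼ ∼ φ
  ∼∼-intro φ = taut (a ⇒ˢ neg (neg a)) valid (assign φ φ φ)
    where
    valid : Tautology (a ⇒ˢ neg (neg a))
    valid v with v 0
    ... | true  = refl
    ... | false = refl

  ∧-intro : (φ ψ : F) → ⊢ φ ⇒ ψ ⇒ φ ∧ ψ
  ∧-intro φ ψ = taut (a ⇒ˢ b ⇒ˢ conj a b) valid (assign φ ψ ψ)
    where
    valid : Tautology (a ⇒ˢ b ⇒ˢ conj a b)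
    valid v with v 0 | v 1
    ... | true  | true  = refl
    ... | true  | false = refl
    ... | false | true  = refl
    ... | false | false = refl

  ∼∧-introˡ : (φ ψ : F) → ⊢ ∼ φ ⇒ ∼ (φ ∧ ψ)
  ∼∧-introˡ φ ψ = taut (neg a ⇒ˢ neg (conj a b)) valid (assign φ ψ ψ)
    where
    valid : Tautology (neg a ⇒ˢ neg (conj a b))
    valid v with v 0 | v 1
    ... | true  | true  = refl
    ... | true  | false = refl
    ... | false | true  = refl
    ... | false | false = refl

  ∼∧-introʳ : (φ ψ : F) → ⊢ ∼ ψ ⇒ ∼ (φ ∧ ψ)
  ∼∧-introʳ φ ψ = taut (neg b ⇒ˢ neg (conj a b)) valid (assign φ ψ ψ)
    where
    valid : Tautology (neg b ⇒ˢ neg (conj a b))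
    valid v with v 0 | v 1
    ... | true  | true  = refl
    ... | true  | false = refl
    ... | false | true  = refl
    ... | false | false = refl

  -- Derivability from hypotheses

  infix 3 _⊩_

  -- Necessitation applies to theorems only, so the deduction theorem holds.
  data _⊩_ (H : List F) : F → Set where
    hyp : ∀ {φ} → φ ∈ˡ H → H ⊩ φ
    thm : ∀ {φ} → ⊢ φ → H ⊩ φ
    mp  : ∀ {φ ψ} → H ⊩ φ ⇒ ψ → H ⊩ φ → H ⊩ ψ

  ⊩-closed : ∀ {φ} → [] ⊩ φ → ⊢ φ
  ⊩-closed (thm d)  = d
  ⊩-closed (mp d e) = mp (⊩-closed d) (⊩-closed e)

  ⊩-cut : ∀ {H H′} → (∀ {φ} → φ ∈ˡ H → H′ ⊩ φ) → ∀ {ψ} → H ⊩ ψ → H′ ⊩ ψ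
  ⊩-cut f (hyp h)  = f h
  ⊩-cut f (thm d)  = thm d
  ⊩-cut f (mp d e) = mp (⊩-cut f d) (⊩-cut f e)

  ⊩-deduct : ∀ {H φ ψ} → φ ∷ H ⊩ ψ → H ⊩ φ ⇒ ψ
  ⊩-deduct (hyp (here refl)) = thm (⇒-refl _)
  ⊩-deduct (hyp (there h))   = mp (thm (⇒-const _ _)) (hyp h)
  ⊩-deduct (thm d)           = thm (mp (⇒-const _ _) d)
  ⊩-deduct (mp d e)          = mp (mp (thm (⇒-distrib _ _ _)) (⊩-deduct d)) (⊩-deduct e)

  ⊩-cases : ∀ {H ψ} φ → φ ∷ H ⊩ ψ → ∼ φ ∷ H ⊩ ψ → H ⊩ ψ
  ⊩-cases φ d e = mp (mp (thm (⇒-cases φ _)) (⊩-deduct d)) (⊩-deduct e)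

  ⊩-explode : ∀ {H φ} → H ⊩ φ → H ⊩ ∼ φ → ∀ ψ → H ⊩ ψ
  ⊩-explode d e ψ = mp (mp (thm (∼-explode _ ψ)) d) e

  ⇒-trans : ∀ {φ ψ χ : F} → ⊢ φ ⇒ ψ → ⊢ ψ ⇒ χ → ⊢ φ ⇒ χ
  ⇒-trans d e = ⊩-closed (⊩-deduct (mp (thm e) (mp (thm d) (hyp (here refl)))))

  -- Modalities

  □ : Modality A → F → F
  □ (know i) = K i
  □ interior = int

  □-K : ∀ m φ ψ → ⊢ □ m (φ ⇒ ψ) ⇒ (□ m φ ⇒ □ m ψ)
  □-K (know i) = K-K i
  □-K interior = int-K

  □-T : ∀ m φ → ⊢ □ m φ ⇒ φ
  □-T (know i) = K-T i
  □-T interior = int-T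

  □-nec : ∀ m {φ} → ⊢ φ → ⊢ □ m φ
  □-nec (know i) = nec-K i
  □-nec interior = nec-int

  -- These are literals that imply their own box. `∼ int φ` is missing because `int` is only an S4
  -- modality, and `int φ` is stable under `interior` alone because no axiom lifts it to knowledge.
  data Stable (m : Modality A) : F → Set where
    K⁺   : ∀ {i φ} → Concerns m i → Stable m (K i φ)
    K⁻   : ∀ {i φ} → Concerns m i → Stable m (∼ K i φ)
    int⁺ : ∀ {φ} → m ≡ interior → Stable m (int φ)

  -- The same agent uses axioms 4 and 5; `interior` weakens the resulting `K i` through `K-int`.
  stable-□ : ∀ {m φ} → Stable m φ → ⊢ φ ⇒ □ m φ
  stable-□ (K⁺ self)   = K-4 _ _
  stable-□ (K⁺ every)  = ⇒-trans (K-4 _ _) (K-int _ _)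
  stable-□ (K⁻ self)   = K-5 _ _
  stable-□ (K⁻ every)  = ⇒-trans (K-5 _ _) (K-int _ _)
  stable-□ (int⁺ refl) = int-4 _

  know⇒interior : ∀ {i φ} → Stable (know i) φ → Stable interior φ
  know⇒interior (K⁺ _) = K⁺ every
  know⇒interior (K⁻ _) = K⁻ every

  -- Stable hypotheses can be boxed, theorems can be necessitated, and `□-K` carries the box through
  -- modus ponens.
  ⊩-□ : ∀ {m H} → (∀ {β} → β ∈ˡ H → Stable m β) → ∀ {φ} → H ⊩ φ → H ⊩ □ m φ
  ⊩-□ st (hyp h)  = mp (thm (stable-□ (st h))) (hyp h)
  ⊩-□ st (thm d)  = thm (□-nec _ d)
  ⊩-□ st (mp d e) = mp (mp (thm (□-K _ _ _)) (⊩-□ st d)) (⊩-□ st e)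

  -- Atomic and modal subformulas, and assignments to them

  units : F → List F
  units (atom p) = atom p ∷ []
  units (∼ φ)    = units φ
  units (φ ∧ ψ)  = units φ ++ units ψ
  units (K i φ)  = K i φ ∷ units φ
  units (int φ)  = int φ ∷ units φ

  units-closed : ∀ φ {γ} → γ ∈ˡ units φ → units γ ⊆ˡ units φ
  units-closed (atom p) (here refl) = id
  units-closed (∼ φ)    γ∈          = units-closed φ γ∈
  units-closed (φ ∧ ψ)  γ∈          =
    [ (λ p → ∈-++⁺ˡ ∘ units-closed φ p)
    , (λ p → ∈-++⁺ʳ (units φ) ∘ units-closed ψ p) ]′ (∈-++⁻ (units φ) γ∈)
  units-closed (K i φ)  (here refl) = id
  units-closed (K i φ)  (there γ∈)  = there ∘ units-closed φ γ∈
  units-closed (int φ)  (here refl) = id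
  units-closed (int φ)  (there γ∈)  = there ∘ units-closed φ γ∈

  -- This separates the two halves of `Γ±` below: a negated member must come from the negated half.
  ∼∉units : ∀ φ {γ} → ∼ γ ∉ˡ units φ
  ∼∉units (atom p) (here ())
  ∼∉units (∼ φ)    γ∈         = ∼∉units φ γ∈
  ∼∉units (φ ∧ ψ)  γ∈         = [ ∼∉units φ , ∼∉units ψ ]′ (∈-++⁻ (units φ) γ∈)
  ∼∉units (K i φ)  (there γ∈) = ∼∉units φ γ∈
  ∼∉units (int φ)  (there γ∈) = ∼∉units φ γ∈

  -- An assignment is a list of literals, so the same object serves as a world and as a list of
  -- hypotheses. If `Γ` has repetitions, some lists contain both `γ` and `∼ γ`; this is harmless,
  -- since `Sat` reads only positive membership.
  assignments : List F → List (List F)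
  assignments []      = [] ∷ []
  assignments (γ ∷ Γ) = map (γ ∷_) (assignments Γ) ++ map (∼ γ ∷_) (assignments Γ)

  assignments-decide : ∀ Γ {t γ} → t ∈ˡ assignments Γ → γ ∈ˡ Γ → γ ∈ˡ t ⊎ ∼ γ ∈ˡ t
  assignments-decide (γ ∷ Γ) t∈ γ∈ with ∈-++⁻ (map (γ ∷_) (assignments Γ)) t∈
  assignments-decide (γ ∷ Γ) t∈ γ∈          | inj₁ t∈ˡ with ∈-map⁻ (γ ∷_) t∈ˡ
  assignments-decide (γ ∷ Γ) t∈ (here refl) | inj₁ t∈ˡ | _ , s∈ , refl = inj₁ (here refl)
  assignments-decide (γ ∷ Γ) t∈ (there γ∈)  | inj₁ t∈ˡ | _ , s∈ , refl =
    [ inj₁ ∘ there , inj₂ ∘ there ]′ (assignments-decide Γ s∈ γ∈)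
  assignments-decide (γ ∷ Γ) t∈ γ∈          | inj₂ t∈ʳ with ∈-map⁻ (∼ γ ∷_) t∈ʳ
  assignments-decide (γ ∷ Γ) t∈ (here refl) | inj₂ t∈ʳ | _ , s∈ , refl = inj₂ (here refl)
  assignments-decide (γ ∷ Γ) t∈ (there γ∈)  | inj₂ t∈ʳ | _ , s∈ , refl =
    [ inj₁ ∘ there , inj₂ ∘ there ]′ (assignments-decide Γ s∈ γ∈)

  -- Iterated case distinction on the members of `Γ`. It replaces the theorem that the disjunction
  -- of all assignments is derivable.
  assignments-cover : ∀ Γ {H χ} → (∀ {t} → t ∈ˡ assignments Γ → t ++ H ⊩ χ) → H ⊩ χ
  assignments-cover []      f = f (here refl)
  assignments-cover (γ ∷ Γ) {H} {χ} f = ⊩-cases γ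
    (assignments-cover Γ λ t∈ → ⊩-cut (hyp ∘ shift) (f (∈-++⁺ˡ (∈-map⁺ (γ ∷_) t∈))))
    (assignments-cover Γ λ t∈ →
      ⊩-cut (hyp ∘ shift) (f (∈-++⁺ʳ (map (γ ∷_) (assignments Γ)) (∈-map⁺ (∼ γ ∷_) t∈))))
    where
    shift : ∀ {t δ} → δ ∷ t ++ H ⊆ˡ t ++ δ ∷ H
    shift {t} (here refl) = ∈-++⁺ʳ t (here refl)
    shift {t} (there p)   = [ ∈-++⁺ˡ , ∈-++⁺ʳ t ∘ there ]′ (∈-++⁻ t p)

  Sat : List F → F → Set
  Sat t (atom p) = atom p ∈ˡ t
  Sat t (∼ φ)    = ¬ Sat t φ
  Sat t (φ ∧ ψ)  = Sat t φ × Sat t ψ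
  Sat t (K i φ)  = K i φ ∈ˡ t
  Sat t (int φ)  = int φ ∈ˡ t

-- Assignments over the subformulas of a fixed formula.

module Elimination {P A : Set} (_≟ᴾ_ : DecidableEquality P) (_≟ᴬ_ : DecidableEquality A)
                   (φ₀ : Form P A) where

  open import Data.List.Membership.DecPropositional (form-≟ _≟ᴾ_ _≟ᴬ_) using (_∈?_)

  private
    F : Set
    F = Form P A

  Γ Γ± : List F
  Γ  = units φ₀
  Γ± = Γ ++ map ∼_ Γ

  𝕋 : List (List F)
  𝕋 = assignments Γ

  concerns? : ∀ m (i : A) → Dec (Concerns m i)
  concerns? (know i) j = map′ (λ { refl → self }) (λ { self → refl }) (i ≟ᴬ j)
  concerns? interior j = yes every

  stable? : ∀ m → Decidable (Stable {P} m)
  stable? m        (atom _)    = no λ ()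
  stable? m        (∼ atom _)  = no λ ()
  stable? m        (∼ ∼ _)     = no λ ()
  stable? m        (∼ (_ ∧ _)) = no λ ()
  stable? m        (∼ K i _)   = map′ K⁻ (λ { (K⁻ c) → c }) (concerns? m i)
  stable? m        (∼ int _)   = no λ ()
  stable? m        (_ ∧ _)     = no λ ()
  stable? m        (K i _)     = map′ K⁺ (λ { (K⁺ c) → c }) (concerns? m i)
  stable? (know _) (int _)     = no λ { (int⁺ ()) }
  stable? interior (int _)     = yes (int⁺ refl)

  sat? : ∀ t → Decidable (Sat t)
  sat? t (atom p) = atom p ∈? t
  sat? t (∼ φ)    = ¬? (sat? t φ)
  sat? t (φ ∧ ψ)  = sat? t φ ×-dec sat? t ψ
  sat? t (K i φ)  = K i φ ∈? t
  sat? t (int φ)  = int φ ∈? t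

  unit-⊩ : ∀ {t γ} → t ∈ˡ 𝕋 → γ ∈ˡ Γ → γ ∉ˡ t → t ⊩ ∼ γ
  unit-⊩ t∈ γ∈ γ∉ = [ (λ p → contradiction p γ∉) , hyp ]′ (assignments-decide Γ t∈ γ∈)

  mutual
    -- Truth and falsity are proved together because negation swaps them. Decidability of `Sat`
    -- removes the double negation, and a unit absent from `t` has its negation in `t`.
    sat-⊩ : ∀ {t} → t ∈ˡ 𝕋 → ∀ φ → units φ ⊆ˡ Γ → Sat t φ → t ⊩ φ
    sat-⊩ t∈ (atom p) sub s       = hyp s
    sat-⊩ t∈ (∼ φ)    sub s       = unsat-⊩ t∈ φ sub s
    sat-⊩ t∈ (φ ∧ ψ)  sub (s , r) =
      mp (mp (thm (∧-intro φ ψ)) (sat-⊩ t∈ φ (sub ∘ ∈-++⁺ˡ) s))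
         (sat-⊩ t∈ ψ (sub ∘ ∈-++⁺ʳ (units φ)) r)
    sat-⊩ t∈ (K i φ)  sub s       = hyp s
    sat-⊩ t∈ (int φ)  sub s       = hyp s

    unsat-⊩ : ∀ {t} → t ∈ˡ 𝕋 → ∀ φ → units φ ⊆ˡ Γ → ¬ Sat t φ → t ⊩ ∼ φ
    unsat-⊩     t∈ (atom p) sub ¬s = unit-⊩ t∈ (sub (here refl)) ¬s
    unsat-⊩ {t} t∈ (∼ φ)    sub ¬s =
      mp (thm (∼∼-intro φ)) (sat-⊩ t∈ φ sub (decidable-stable (sat? t φ) ¬s))
    unsat-⊩ {t} t∈ (φ ∧ ψ)  sub ¬s with sat? t φ
    ... | yes s = mp (thm (∼∧-introʳ φ ψ)) (unsat-⊩ t∈ ψ (sub ∘ ∈-++⁺ʳ (units φ)) λ r → ¬s (s , r))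
    ... | no ¬p = mp (thm (∼∧-introˡ φ ψ)) (unsat-⊩ t∈ φ (sub ∘ ∈-++⁺ˡ) ¬p)
    unsat-⊩     t∈ (K i φ)  sub ¬s = unit-⊩ t∈ (sub (here refl)) ¬s
    unsat-⊩     t∈ (int φ)  sub ¬s = unit-⊩ t∈ (sub (here refl)) ¬s

  literal-units : ∀ {β} → β ∈ˡ Γ± → units β ⊆ˡ Γ
  literal-units β∈ with ∈-++⁻ Γ β∈
  ... | inj₁ p = units-closed φ₀ p
  ... | inj₂ p with ∈-map⁻ ∼_ p
  ...   | _ , γ∈ , refl = units-closed φ₀ γ∈

  -- Closure of `Γ±` under changing the sign of a `K` literal is what makes the knowledge relation
  -- symmetric.
  K-literal⁺ : ∀ {i φ} → K i φ ∈ˡ Γ± → ∼ K i φ ∈ˡ Γ±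
  K-literal⁺ β∈ with ∈-++⁻ Γ β∈
  ... | inj₁ p = ∈-++⁺ʳ Γ (∈-map⁺ ∼_ p)
  ... | inj₂ p with ∈-map⁻ ∼_ p
  ...   | _ , _ , ()

  K-literal⁻ : ∀ {i φ} → ∼ K i φ ∈ˡ Γ± → K i φ ∈ˡ Γ±
  K-literal⁻ β∈ with ∈-++⁻ Γ β∈
  ... | inj₁ p = contradiction p (∼∉units φ₀)
  ... | inj₂ p with ∈-map⁻ ∼_ p
  ...   | _ , γ∈ , refl = ∈-++⁺ˡ γ∈

  -- The accessibility relations.

  persists? : ∀ m t → Decidable (λ β → Stable m β × Sat t β)
  persists? m t β = stable? m β ×-dec sat? t β

  persistent : Modality A → List F → List F
  persistent m t = filter (persists? m t) Γ±

  -- A finite form of the canonical relation: `s` inherits every stable literal true at `t`. Only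
  -- candidates from the finite list `Γ±` are tested, which keeps the relation decidable.
  R : Modality A → List F → List F → Set
  R m t s = All (Sat s) (persistent m t)

  R? : ∀ m t s → Dec (R m t s)
  R? m t s = all? (sat? s) (persistent m t)

  R⁺ : ∀ {m t s} → (∀ {β} → β ∈ˡ Γ± → Stable m β → Sat t β → Sat s β) → R m t s
  R⁺ {m} {t} f = tabulate λ p →
    let β∈ , st , sat = ∈-filter⁻ (persists? m t) p in f β∈ st sat

  R⁻ : ∀ {m t s β} → R m t s → β ∈ˡ Γ± → Stable m β → Sat t β → Sat s β
  R⁻ {m} {t} r β∈ st sat = lookup r (∈-filter⁺ (persists? m t) β∈ (st , sat))

  R-refl : ∀ {m t} → R m t t
  R-refl = R⁺ λ _ _ → id

  R-trans : ∀ {m t s u} → R m t s → R m s u → R m t u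
  R-trans r q = R⁺ λ β∈ st → R⁻ q β∈ st ∘ R⁻ r β∈ st

  -- Semantic counterpart of `K-int`: every literal stable for an agent is stable for `interior`. It
  -- makes the knowledge classes open.
  R-interior⇒know : ∀ {i t s} → R interior t s → R (know i) t s
  R-interior⇒know r = R⁺ λ β∈ st → R⁻ r β∈ (know⇒interior st)

  -- Both signs of a `K i` literal are stable. If `K i φ` held at `s` but not at `t`, its negation
  -- would pass from `t` to `s`.
  R-sym : ∀ {i t s} → R (know i) t s → R (know i) s t
  R-sym {i} {t} {s} r = R⁺ back
    where
    back : ∀ {β} → β ∈ˡ Γ± → Stable (know i) β → Sat s β → Sat t β
    back {β} β∈ (K⁺ c) sat =
      decidable-stable (sat? t β) λ ¬p → R⁻ r (K-literal⁺ β∈) (K⁻ c) ¬p sat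
    back     β∈ (K⁻ c) sat = λ p → sat (R⁻ r (K-literal⁻ β∈) (K⁺ c) p)

  -- Defects of assignments and their elimination.

  Fulfilled : List (List F) → List F → Modality A → F → Set
  Fulfilled S t m ψ =
    (Sat t (□ m ψ) → Sat t ψ) × (¬ Sat t (□ m ψ) → Any (λ s → R m t s × ¬ Sat s ψ) S)

  fulfilled? : ∀ S t m ψ → Dec (Fulfilled S t m ψ)
  fulfilled? S t m ψ =
    (sat? t (□ m ψ) →-dec sat? t ψ) ×-dec
    (¬? (sat? t (□ m ψ)) →-dec any? (λ s → R? m t s ×-dec ¬? (sat? s ψ)) S)

  GoodAt : List (List F) → List F → F → Set
  GoodAt S t (K i ψ) = Fulfilled S t (know i) ψ
  GoodAt S t (int ψ) = Fulfilled S t interior ψ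
  GoodAt S t _       = ⊤

  goodAt? : ∀ S t → Decidable (GoodAt S t)
  goodAt? S t (atom _) = yes tt
  goodAt? S t (∼ _)    = yes tt
  goodAt? S t (_ ∧ _)  = yes tt
  goodAt? S t (K i ψ)  = fulfilled? S t (know i) ψ
  goodAt? S t (int ψ)  = fulfilled? S t interior ψ

  Good : List (List F) → List F → Set
  Good S t = All (GoodAt S t) Γ

  good? : ∀ S → Decidable (Good S)
  good? S t = all? (goodAt? S t) Γ

  -- Inconsistency is expressed as deriving everything, as the language has no primitive falsum.
  Refuted : List F → Set
  Refuted t = ∀ χ → t ⊩ χ

  -- The loop invariant of the elimination.
  Exhaustive : List (List F) → Set
  Exhaustive S = ∀ {t} → t ∈ˡ 𝕋 → t ∈ˡ S ⊎ Refuted t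

  module _ {S : List (List F)} (ex : Exhaustive S) {t : List F} (t∈ : t ∈ˡ 𝕋) where

    -- Case distinction over all assignments `s`: a discarded one is inconsistent, a surviving
    -- related one satisfies `ψ` because no witness against it exists, and an unrelated one
    -- contradicts a persistent literal.
    persistent-⊩ : ∀ {m ψ} → units ψ ⊆ˡ Γ →
                   ¬ Any (λ s → R m t s × ¬ Sat s ψ) S → persistent m t ⊩ ψ
    persistent-⊩ {m} {ψ} sub ¬any = assignments-cover Γ step
      where
      step : ∀ {s} → s ∈ˡ 𝕋 → s ++ persistent m t ⊩ ψ
      step {s} s∈ with ex s∈
      ... | inj₂ ref = ⊩-cut (hyp ∘ ∈-++⁺ˡ) (ref ψ)
      ... | inj₁ s∈S with R? m t s
      ...   | yes r = ⊩-cut (hyp ∘ ∈-++⁺ˡ) (sat-⊩ s∈ ψ sub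
                        (decidable-stable (sat? s ψ) λ ¬p → ¬any (lose s∈S (r , ¬p))))
      -- Some persistent `β` fails at `s`, so the literals of `s` derive `∼ β`.
      ...   | no ¬r with find (¬All⇒Any¬ (sat? s) _ ¬r)
      ...     | β , β∈ , ¬p = ⊩-explode
                (hyp (∈-++⁺ʳ s β∈))
                (⊩-cut (hyp ∘ ∈-++⁺ˡ) (unsat-⊩ s∈ β
                  (literal-units (proj₁ (∈-filter⁻ (persists? m t) β∈))) ¬p))
                ψ

    ⊩-persistent : ∀ {m β} → β ∈ˡ persistent m t → t ⊩ β
    ⊩-persistent {m} {β} β∈ =
      let β∈± , _ , sat = ∈-filter⁻ (persists? m t) β∈
      in sat-⊩ t∈ β (literal-units β∈±) sat

    -- A violation of T contradicts `□-T`. If a witness is missing, the persistent literals derive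
    -- `ψ`; being stable they derive `□ m ψ`, which `t` refutes.
    unfulfilled⇒refuted : ∀ m ψ → units (□ m ψ) ⊆ˡ Γ → units ψ ⊆ˡ Γ →
                          ¬ Fulfilled S t m ψ → Refuted t
    unfulfilled⇒refuted m ψ sub□ sub ¬ful with sat? t (□ m ψ) | sat? t ψ
    ... | yes b | yes s = contradiction (const s , contradiction b) ¬ful
    ... | yes b | no ¬s = ⊩-explode (mp (thm (□-T m ψ)) (sat-⊩ t∈ _ sub□ b)) (unsat-⊩ t∈ ψ sub ¬s)
    ... | no ¬b | _     = ⊩-explode
      (⊩-cut ⊩-persistent (⊩-□ stable (persistent-⊩ sub λ any →
        ¬ful ((λ b → contradiction b ¬b) , const any))))
      (unsat-⊩ t∈ _ sub□ ¬b)
      where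
      stable : ∀ {β} → β ∈ˡ persistent m t → Stable m β
      stable β∈ = proj₁ (proj₂ (∈-filter⁻ (persists? m t) {xs = Γ±} β∈))

    bad⇒refuted : ¬ Good S t → Refuted t
    bad⇒refuted ¬good with find (¬All⇒Any¬ (goodAt? S t) Γ ¬good)
    ... | atom _ , _  , ¬g = contradiction tt ¬g
    ... | ∼ _    , _  , ¬g = contradiction tt ¬g
    ... | _ ∧ _  , _  , ¬g = contradiction tt ¬g
    ... | K i ψ  , γ∈ , ¬g =
      unfulfilled⇒refuted (know i) ψ (units-closed φ₀ γ∈) (units-closed φ₀ γ∈ ∘ there) ¬g
    ... | int ψ  , γ∈ , ¬g =
      unfulfilled⇒refuted interior ψ (units-closed φ₀ γ∈) (units-closed φ₀ γ∈ ∘ there) ¬g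

  -- Each round drops all bad assignments at once and so shortens the list. Their refutations use
  -- exhaustiveness of the list before the round.
  eliminate : ∀ S → Acc _<_ (length S) → Exhaustive S →
              ∃ λ S′ → Exhaustive S′ × All (Good S′) S′
  eliminate S (acc rec) ex with all? (good? S) S
  ... | yes good = S , ex , good
  ... | no ¬good = eliminate (filter (good? S) S)
                     (rec (filter-notAll (good? S) S (¬All⇒Any¬ (good? S) S ¬good))) ex′
    where
    ex′ : Exhaustive (filter (good? S) S)
    ex′ {t} t∈ with ex t∈
    ... | inj₂ ref = inj₂ ref
    ... | inj₁ t∈S with good? S t
    ...   | yes g = inj₁ (∈-filter⁺ (good? S) t∈S g)
    ...   | no ¬g = inj₂ (bad⇒refuted ex t∈ ¬g)

  -- The topo-model of surviving assignments.

  module Model (S : List (List F)) (good : All (Good S) S) where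

    World : Set
    World = ∃ (_∈ˡ S)

    -- The Alexandrov topology of the `interior` preorder.
    τ : Topology World
    τ = record
      { Open      = λ O → Lift (lsuc 0ℓ) (∀ {x y} → R interior (proj₁ x) (proj₁ y) → x ∈ O → y ∈ O)
      ; Open-resp = λ (f , g) (lift up) → lift λ r → f ∘ up r ∘ g
      ; Open-∅    = lift λ _ ()
      ; Open-U    = lift _
      ; Open-∩    = λ (lift up) (lift up′) → lift λ r (p , q) → up r p , up′ r q
      ; Open-⋃    = λ I O ups → lift λ r (i , p) → i , lower (ups i) r p
      }

    open Topology τ

    -- Conditions (1) to (4) on a single partial function. Taking all such functions as the
    -- neighbourhood function set gives closure under restriction, with no need to generate it from
    -- `classes`.
    record Neighbourhood (θ : PartialFn World A) : Set₁ where
      field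
        opn : ∀ x (d : x ∈ Dom θ) i → Open (app θ x d i)
        rfl : ∀ x (d : x ∈ Dom θ) i → x ∈ app θ x d i
        sub : ∀ x (d : x ∈ Dom θ) i → app θ x d i ⊆ Dom θ
        cls : ∀ x y (d : x ∈ Dom θ) (e : y ∈ Dom θ) i → y ∈ app θ x d i → app θ x d i ≐ app θ y e i

    open Neighbourhood

    isNbhdFnSet : IsNbhdFnSet A τ Neighbourhood
    isNbhdFnSet = record
      { resp     = λ ((f , g) , h) n → record
          { opn = λ x d i → Open-resp (h x (g d) d i) (opn n x (g d) i)
          ; rfl = λ x d i → proj₁ (h x (g d) d i) (rfl n x (g d) i)
          ; sub = λ x d i → f ∘ sub n x (g d) i ∘ proj₂ (h x (g d) d i)
          ; cls = λ x y d e i p →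
              let u , v = cls n x y (g d) (g e) i (proj₂ (h x (g d) d i) p)
              in proj₁ (h y (g e) e i) ∘ u ∘ proj₂ (h x (g d) d i)
               , proj₁ (h x (g d) d i) ∘ v ∘ proj₂ (h y (g e) e i)
          }
      ; open-val = opn
      ; refl-val = rfl
      ; val⊆Dom  = sub
      ; val-≐    = cls
      ; restrict = λ n O op → record
          { opn = λ x (d , _) i → Open-∩ (opn n x d i) op
          ; rfl = λ x (d , o) i → rfl n x d i , o
          ; sub = λ x (d , _) i (p , o) → sub n x d i p , o
          ; cls = λ x y (d , _) (e , _) i (p , _) →
              let u , v = cls n x y d e i p
              in (λ (q , o) → u q , o) , (λ (q , o) → v q , o)
          }
      }

    model : TopoModel P A
    model = record
      { X = World ; τ = τ ; Φ = Neighbourhood ; isNbhdFnSet = isNbhdFnSet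
      ; V = λ p (t , _) → atom p ∈ˡ t }

    open Semantics model

    classes : PartialFn World A
    classes = record
      { Dom     = U
      ; app     = λ (t , _) _ i (s , _) → R (know i) t s
      ; app-irr = λ _ _ _ _ → id , id
      }

    classes-nbhd : Neighbourhood classes
    classes-nbhd = record
      -- An `interior` step stays inside a knowledge class, so classes are up-sets.
      { opn = λ x d i → lift λ r p → R-trans p (R-interior⇒know r)
      ; rfl = λ x d i → R-refl
      ; sub = λ x d i _ → tt
      ; cls = λ x y d e i p → R-trans (R-sym p) , R-trans p
      }

    at : World → Situation
    at x = ⟨ x , classes , classes-nbhd , tt ⟩

    fulfilled-K : ∀ {t i ψ} → t ∈ˡ S → K i ψ ∈ˡ Γ → Fulfilled S t (know i) ψ
    fulfilled-K t∈ γ∈ = lookup (lookup good t∈) γ∈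

    fulfilled-int : ∀ {t ψ} → t ∈ˡ S → int ψ ∈ˡ Γ → Fulfilled S t interior ψ
    fulfilled-int t∈ γ∈ = lookup (lookup good t∈) γ∈

    -- In the modal cases, a false box has a surviving witness, while a true box is itself stable,
    -- passes to every related world and yields its body there by T.
    truth : ∀ φ → units φ ⊆ˡ Γ → ∀ x → at x ⊨ φ ⇔ Sat (proj₁ x) φ
    truth (atom p) sub x = mk⇔ lower lift
    truth (∼ φ) sub x = mk⇔ (_∘ from (truth φ sub x)) (_∘ to (truth φ sub x))
    truth (φ ∧ ψ) sub x = mk⇔
      (λ (p , q) → to ihφ p , to ihψ q)
      (λ (p , q) → from ihφ p , from ihψ q)
      where
      ihφ = truth φ (sub ∘ ∈-++⁺ˡ) x
      ihψ = truth ψ (sub ∘ ∈-++⁺ʳ (units φ)) x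
    truth (K i φ) sub x@(t , t∈) = mk⇔
      (λ all → decidable-stable (sat? t (K i φ)) λ ¬k →
        let s , s∈ , r , ¬p = find (proj₂ (fulfilled-K t∈ Kφ∈) ¬k)
        in ¬p (to (ih (s , s∈)) (all (s , s∈) r)))
      (λ k y@(s , s∈) r → from (ih y)
        (proj₁ (fulfilled-K s∈ Kφ∈) (R⁻ r (∈-++⁺ˡ Kφ∈) (K⁺ self) k)))
      where
      Kφ∈ = sub (here refl)
      ih = truth φ (sub ∘ there)
    truth (int φ) sub x@(t , t∈) = mk⇔
      (λ (O , lift up , O⊆ , x∈O) → decidable-stable (sat? t (int φ)) λ ¬k →
        let s , s∈ , r , ¬p = find (proj₂ (fulfilled-int t∈ intφ∈) ¬k)
        in ¬p (to (ih (s , s∈)) (proj₂ (O⊆ (up r x∈O)))))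
      -- The witness is the least open set containing `x`.
      (λ k → cone , lift (λ {x} {y} → cone-up {x} {y}) , (λ {y} → cone⊆ k {y}) , R-refl)
      where
      intφ∈ = sub (here refl)
      ih = truth φ (sub ∘ there)

      cone : Pred World 0ℓ
      cone (s , _) = R interior t s

      cone-up : ∀ {x y : World} → R interior (proj₁ x) (proj₁ y) → x ∈ cone → y ∈ cone
      cone-up r p = R-trans p r

      cone⊆ : int φ ∈ˡ t → cone ⊆ λ y → ∃ λ (_ : ⊤) → at y ⊨ φ
      cone⊆ k {s , s∈} r = tt ,
        from (ih (s , s∈)) (proj₁ (fulfilled-int s∈ intφ∈) (R⁻ r (∈-++⁺ˡ intφ∈) (int⁺ refl) k))

  complete : ((M : TopoModel P A) → ValidIn M φ₀) → ⊢ φ₀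
  -- Initially nothing has been discarded, so exhaustiveness is immediate.
  complete valid with eliminate 𝕋 (<-wellFounded _) inj₁
  ... | S , ex , good = ⊩-closed (assignments-cover Γ step)
    where
    open Model S good
    step : ∀ {t} → t ∈ˡ 𝕋 → t ++ [] ⊩ φ₀
    step t∈ = ⊩-cut (hyp ∘ ∈-++⁺ˡ) ([
        (λ t∈S → sat-⊩ t∈ φ₀ id (to (truth φ₀ id (_ , t∈S)) (valid model (at (_ , t∈S)))))
      , (λ ref → ref φ₀) ]′ (ex t∈))

theorem2 : (Prop Agent : Set) → Prop ↣ ℕ → (n : ℕ) → Agent ↔ Fin (suc n) →
    (φ : Form Prop Agent) → ((M : TopoModel Prop Agent) → ValidIn M φ) → ⊢ φ
theorem2 Prop Agent inj n fin φ =
  Elimination.complete (via-injection inj _≟ⁿ_) (via-injection (↔⇒↣ fin) _≟ᶠ_) φ
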